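{- For every $n>0$, the map $\Phi$ is a bijection from the set of ADI words of DI-sortable permutations of $[n]$ to the set of Schröder paths from $(0,0)$ to $(n-1,n-1)$.
   Context: A permutation $\pi=\pi_1\cdots\pi_n$ of $[n]$ is processed by a machine consisting of an input (initially $\pi_1,\dots,\pi_n$), a first stack, a second stack, and an output, with operations: $\mathsf{E}$ moves the next input entry onto the top of the first stack; $\mathsf{N}$ pops the top of the first stack and pushes it onto the second stack; $\mathsf{C}$ pops the top of the second stack to the output. A DI word of $\pi$ is a word over $\{\mathsf{E},\mathsf{N},\mathsf{C}\}$ whose operations are all legal when applied in order starting from $\pi$ in the input and empty stacks, whose final output is $12\cdots n$, and during which the first stack's entries always decrease from top to bottom and the second stack's entries always increase from top to bottom; $\pi$ is DI-sortable if it has a DI word. The ADI word of a DI-sortable $\pi$ is the word of operations performed by the following algorithm, which at each stage performs the first applicable step: (1) if the top entry of the second stack is the smallest value not yet output, perform $\mathsf{C}$; (2) if the first stack is nonempty and its $m$ entries are exactly the next $m$ values to be output, transfer all of them to the second stack by $m$ successive $\mathsf{N}$ operations; (3) otherwise, if the next input entry is smaller than the top of the second stack and larger than the top of the first stack (each comparison counting as satisfied if the corresponding stack is empty), perform $\mathsf{E}$; (4) otherwise perform $\mathsf{N}$. In an ADI word, every maximal block of consecutive $\mathsf{C}$'s is immediately preceded by $\mathsf{E}\mathsf{N}$. The map $\Phi$: given an ADI word $W$ with $k$ maximal blocks of consecutive $\mathsf{C}$'s of lengths $\tau_1,\dots,\tau_k$ (in order), set $\ell_i=\tau_1+\cdots+\tau_i$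 (so $\ell_k=n$). Form $T$ by replacing each substring $\mathsf{E}\mathsf{N}\mathsf{C}^{\tau_i}$ (a maximal block of $\mathsf{C}$'s together with the two letters preceding it) by a single $\mathsf{N}$. Form $S_{\mathsf{D}}$ from $T$ by replacing, for each $i\in[k]$, the $\ell_i$-th $\mathsf{N}$ of $T$ by $\mathsf{D}$; delete the final letter (a $\mathsf{D}$) of $S_{\mathsf{D}}$ to obtain $\Phi(W)$. A Schröder path from $(0,0)$ to $(m,m)$ is a word over $\{\mathsf{E},\mathsf{N},\mathsf{D}\}$ read as a lattice path with steps $\mathsf{E}=(1,0)$, $\mathsf{N}=(0,1)$, $\mathsf{D}=(1,1)$, starting at $(0,0)$, ending at $(m,m)$, and staying weakly below the line $y=x$ (for $m=0$, the empty path). -}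

module Defs where

open import Data.Nat using (ℕ; zero; suc; _+_; _*_; _≤_; _<ᵇ_; _≡ᵇ_)
open import Data.Bool using (Bool; true; false; _∧_; _∨_; not; if_then_else_)
open import Data.List using (List; []; _∷_; _++_; [_]; map; length; take; replicate; upTo)
open import Data.Maybe using (Maybe; just; nothing)
open import Data.Product using (_×_; _,_; proj₁; proj₂; Σ; ∃)
open import Data.List.Relation.Binary.Permutation.Propositional using (_↭_)
open import Relation.Binary.PropositionalEquality using (_≡_)
open import Data.Empty using (⊥)
open import Data.Unit using (⊤)

-- Alphabet.  Machine words use E, N, C; Schröder paths use E, N, D.

data Letter : Set where
  E N C D : Letter

elemᵇ : ℕ → List ℕ → Bool
elemᵇ x []       = false
elemᵇ x (y ∷ ys) = (x ≡ᵇ y) ∨ elemᵇ x ys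

allᵇ : (ℕ → Bool) → List ℕ → Bool
allᵇ p []       = true
allᵇ p (x ∷ xs) = p x ∧ allᵇ p xs

filterᵇ : (ℕ → Bool) → List ℕ → List ℕ
filterᵇ p [] = []
filterᵇ p (x ∷ xs) = if p x then x ∷ filterᵇ p xs else filterᵇ p xs

vals : ℕ → List ℕ
vals n = map suc (upTo n)

IsPerm : ℕ → List ℕ → Set
IsPerm n π = π ↭ vals n

-- The machine.  Stacks are lists with the top entry first;
-- the output is listed in the order it was produced.

record MState : Set where
  constructor mstate
  field
    input  : List ℕ
    stack1 : List ℕ
    stack2 : List ℕ
    output : List ℕ
open MState public

initState : List ℕ → MState
initState π = mstate π [] [] []

applyOp : Letter → MState → Maybe MState
applyOp E (mstate (x ∷ i) s1 s2 o) = just (mstate i (x ∷ s1) s2 o)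
applyOp N (mstate i (x ∷ s1) s2 o) = just (mstate i s1 (x ∷ s2) o)
applyOp C (mstate i s1 (x ∷ s2) o) = just (mstate i s1 s2 (o ++ [ x ]))
applyOp _ _ = nothing

decreasingᵇ : List ℕ → Bool
decreasingᵇ []           = true
decreasingᵇ (x ∷ [])     = true
decreasingᵇ (x ∷ y ∷ xs) = (y <ᵇ x) ∧ decreasingᵇ (y ∷ xs)

increasingᵇ : List ℕ → Bool
increasingᵇ []           = true
increasingᵇ (x ∷ [])     = true
increasingᵇ (x ∷ y ∷ xs) = (x <ᵇ y) ∧ increasingᵇ (y ∷ xs)

stacksOKᵇ : MState → Bool
stacksOKᵇ s = decreasingᵇ (stack1 s) ∧ increasingᵇ (stack2 s)

runDI : List Letter → MState → Maybe MState
runDI []      s = just s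
runDI (l ∷ w) s with applyOp l s
... | nothing = nothing
... | just s' = if stacksOKᵇ s' then runDI w s' else nothing

IsDIWord : List ℕ → List Letter → Set
IsDIWord π w = Σ MState λ s → (runDI w (initState π) ≡ just s) × (output s ≡ vals (length π))

DISortable : List ℕ → Set
DISortable π = ∃ λ w → IsDIWord π w

notYetOutput : ℕ → MState → List ℕ
notYetOutput n s = filterᵇ (λ v → not (elemᵇ v (output s))) (vals n)

step1ᵇ : ℕ → MState → Bool
step1ᵇ n s with stack2 s | notYetOutput n s
... | t ∷ _ | v ∷ _ = t ≡ᵇ v
... | _     | _     = false

step2ᵇ : ℕ → MState → Bool
step2ᵇ n s with stack1 s
... | [] = false
... | st@(_ ∷ _) =
  let m   = length st
      nxt = take m (notYetOutput n s)
  in (length nxt ≡ᵇ m) ∧ allᵇ (λ x → elemᵇ x nxt) st ∧ allᵇ (λ x → elemᵇ x st) nxt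

step3ᵇ : MState → Bool
step3ᵇ (mstate [] _ _ _) = false
step3ᵇ (mstate (x ∷ _) s1 s2 _) = below s2 ∧ above s1
  where
  below : List ℕ → Bool
  below []      = true
  below (t ∷ _) = x <ᵇ t
  above : List ℕ → Bool
  above []      = true
  above (t ∷ _) = t <ᵇ x

applyWord : List Letter → MState → Maybe MState
applyWord []      s = just s
applyWord (l ∷ w) s with applyOp l s
... | nothing = nothing
... | just s' = applyWord w s'

adiStage : ℕ → MState → List Letter
adiStage n s =
  if step1ᵇ n s then [ C ]
  else if step2ᵇ n s then replicate (length (stack1 s)) N
  else if step3ᵇ s then [ E ]
  else [ N ]

isDoneᵇ : MState → Bool
isDoneᵇ (mstate [] [] [] _) = true
isDoneᵇ _ = false

runADI : ℕ → ℕ → MState → Maybe (List Letter)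
runADI n zero s = if isDoneᵇ s then just [] else nothing
runADI n (suc f) s with isDoneᵇ s
... | true  = just []
... | false with applyWord (adiStage n s) s
...   | nothing = nothing
...   | just s' with runADI n f s'
...     | nothing = nothing
...     | just w  = just (adiStage n s ++ w)

-- The ADI word of π (each stage performs ≥ 1 operation and a successful
-- run performs exactly 3n operations, so 3n stages suffice).
adi : List ℕ → Maybe (List Letter)
adi π = runADI (length π) (3 * length π) (initState π)

IsADIWord : ℕ → List Letter → Set
IsADIWord n W = ∃ λ π → IsPerm n π × DISortable π × (adi π ≡ just W)

mutual
  phiT : List Letter → List Letter
  phiT (E ∷ N ∷ C ∷ r) = N ∷ skipC r
  phiT (x ∷ r)         = x ∷ phiT r
  phiT []              = []

  skipC : List Letter → List Letter
  skipC (C ∷ r) = skipC r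
  skipC r       = phiT r

mutual
  taus : List Letter → List ℕ
  taus (E ∷ N ∷ C ∷ r) = countC 1 r
  taus (x ∷ r)         = taus r
  taus []              = []

  countC : ℕ → List Letter → List ℕ
  countC k (C ∷ r) = countC (suc k) r
  countC k r       = k ∷ taus r

partialSums : ℕ → List ℕ → List ℕ
partialSums acc []       = []
partialSums acc (t ∷ ts) = (acc + t) ∷ partialSums (acc + t) ts

markD : ℕ → List ℕ → List Letter → List Letter
markD c ls []      = []
markD c ls (N ∷ r) = (if elemᵇ (suc c) ls then D else N) ∷ markD (suc c) ls r
markD c ls (x ∷ r) = x ∷ markD c ls r

dropLast : List Letter → List Letter
dropLast []          = []
dropLast (x ∷ [])    = []
dropLast (x ∷ y ∷ r) = x ∷ dropLast (y ∷ r)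

Φ : List Letter → List Letter
Φ W = dropLast (markD 0 (partialSums 0 (taus W)) (phiT W))

-- endpoint (x , y) of a path from the origin (C is not a path step; words
-- containing C are excluded by `AllSteps`)
endpoint : List Letter → ℕ × ℕ
endpoint [] = 0 , 0
endpoint (l ∷ w) with endpoint w
... | x , y = step l x y
  where
  step : Letter → ℕ → ℕ → ℕ × ℕ
  step E x y = suc x , y
  step N x y = x , suc y
  step D x y = suc x , suc y
  step C x y = x , y

ValidStep : Letter → Set
ValidStep C = ⊥
ValidStep _ = ⊤

data AllSteps : List Letter → Set where
  []  : AllSteps []
  _∷_ : ∀ {l w} → ValidStep l → AllSteps w → AllSteps (l ∷ w)

IsSchroderPath : ℕ → List Letter → Set
IsSchroderPath m w =
  AllSteps w ×
  (∀ k → proj₂ (endpoint (take k w)) ≤ proj₁ (endpoint (take k w))) ×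
  (endpoint w ≡ (m , m))

{-# OPTIONS --safe #-}
-- A finished run of the algorithm outputs only through step (1), hence outputs
-- 1 ⋯ n, and the stacks are then ordered automatically; so the ADI words are
-- the words that the algorithm can complete, with no appeal to its optimality.
-- A value c + 1 that is about to be output enters an empty first stack, so
-- step (2) only ever moves a single entry, and ADI words are the words
-- B₁ E N C^τ₁ ⋯ B_k E N C^τ_k with B_i balanced in E and N.  Conversely every
-- such legal word determines a permutation, read off backwards, on which the
-- algorithm performs it.  Call a row of the path set when it is crossed by D:
-- the row bits are the C's of the word in order, the last C of a block being
-- set.  Reading a path with a queue of row bits reconstructs the word: a row
-- met with an empty first stack is an E N followed by C's for the bits up to
-- the first set one.  The path height x − y is the size of the first stack plus
-- the number of set bits in the queue, so staying weakly below the diagonal is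
-- exactly the condition that this never fails.
module Submission where

open import Defs
open import Data.Bool using (Bool; true; false; _∧_; _∨_; not; if_then_else_)
open import Data.Bool.Properties using (∧-zeroʳ; ∨-zeroʳ; T-≡; ¬-not)
open import Data.Empty using (⊥-elim)
open import Data.List using (List; []; _∷_; _++_; [_]; _∷ʳ_; map; length; take; replicate; upTo; initLast; _∷ʳ′_)
open import Data.List.Properties using (∷ʳ-injective; ++-assoc; ++-identityʳ; length-++; upTo-∷ʳ; map-++; length-map; length-upTo)
open import Data.List.Membership.Propositional using (_∈_)
open import Data.List.Membership.Propositional.Properties using (∈-insert; ∈-++⁺ʳ)
open import Data.List.Relation.Binary.Permutation.Propositional using (_↭_; ↭-trans; ↭-sym; ↭-refl; prep)
open import Data.List.Relation.Binary.Permutation.Propositional.Properties using (∈-resp-↭; All-resp-↭; ↭-length; drop-∷; ++⁺ˡ) renaming (shift to ↭-shift)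
open import Data.List.Relation.Unary.All as All using (All; []; _∷_)
open import Data.List.Relation.Unary.All.Properties using (++⁺; ++⁻ʳ)
open import Data.List.Relation.Unary.AllPairs using (AllPairs; []; _∷_)
open import Data.List.Relation.Unary.Any using (here; there)
open import Data.Maybe using (just)
open import Data.Nat using (ℕ; zero; suc; _+_; _*_; _∸_; _≤_; _<_; _>_; _<ᵇ_; _≡ᵇ_; z≤n; s≤s; s≤s⁻¹)
open import Data.Nat.Properties
open import Data.Nat.Tactic.RingSolver using (solve-∀)
open import Data.Product using (_×_; _,_; proj₁; proj₂; ∃; ∃-syntax)
open import Data.Sum using (_⊎_; inj₁; inj₂)
open import Data.Unit using (⊤; tt)
open import Function using (_∘_)
open import Function.Bundles using (Equivalence)
open import Relation.Nullary using (yes; no)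
open import Relation.Binary.PropositionalEquality using (_≡_; _≢_; refl; sym; trans; ≢-sym; cong; cong₂; subst; subst₂; module ≡-Reasoning)

≡ᵇ-refl : ∀ n → (n ≡ᵇ n) ≡ true
≡ᵇ-refl n = Equivalence.to T-≡ (≡⇒≡ᵇ n n refl)

≢⇒≡ᵇ-false : ∀ {m n} → m ≢ n → (m ≡ᵇ n) ≡ false
≢⇒≡ᵇ-false {m} {n} m≢n = ¬-not (m≢n ∘ ≡ᵇ⇒≡ m n ∘ Equivalence.from T-≡)

-- A row of a path is crossed by a diagonal step when its bit is set.
data Row : Bool → Letter → Set where
  north : Row false N
  diag  : Row true D

-- Run h q w p reads a suffix w of a word and the corresponding suffix p of
-- its path (with the final D kept) from a moment at which the first stack has
-- h entries.  The queue q has one bit per entry of the second stack: the bits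
-- of the rows that p has crossed but whose C's have not yet occurred in w.
data Run : ℕ → List Bool → List Letter → List Letter → Set
data Drain : List Bool → List Letter → List Letter → Set

data Run where
  done  : Run 0 [] [] []
  push  : ∀ {h q w p} → Run (suc h) q w p → Run h q (E ∷ w) (E ∷ p)
  shift : ∀ {h q b l w p} → Row b l → Run h (q ∷ʳ b) w p → Run (suc h) q (N ∷ w) (l ∷ p)
  burst : ∀ {q b l w p} → Row b l → Drain (q ∷ʳ b) w p → Run 0 q (E ∷ N ∷ w) (l ∷ p)

-- One block of C's: clear bits prolong it and the first set bit ends it. Bits leave first in, first
-- out, although stack entries do not: a bit belongs to a rank (the i-th N and the i-th C), not to a
-- value.
data Drain where
  more : ∀ {q w p} → Drain q w p → Drain (false ∷ q) (C ∷ w) p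
  last : ∀ {q w p} → Run 0 q w p → Drain (true ∷ q) (C ∷ w) p

Row-unique : ∀ {b b′ l} → Row b l → Row b′ l → b ≡ b′
Row-unique north north = refl
Row-unique diag  diag  = refl

-- Reading is deterministic: an east step is a `push`, a row is a `shift` or a `burst` according to
-- whether `h` is positive, and the front bit chooses the constructor of `Drain`.
Run-unique : ∀ {h q w w′ p} → Run h q w p → Run h q w′ p → w ≡ w′
Drain-unique : ∀ {q w w′ p} → Drain q w p → Drain q w′ p → w ≡ w′
Run-unique done done = refl
Run-unique (push r) (push r′) = cong (E ∷_) (Run-unique r r′)
Run-unique (push r) (burst () _)
Run-unique (shift () _) (push r′)
Run-unique (shift x r) (shift x′ r′) with Row-unique x x′
... | refl = cong (N ∷_) (Run-unique r r′)
Run-unique (burst () _) (push _)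
Run-unique (burst x d) (burst x′ d′) with Row-unique x x′
... | refl = cong (λ w → E ∷ N ∷ w) (Drain-unique d d′)
Drain-unique (more d) (more d′) = cong (C ∷_) (Drain-unique d d′)
Drain-unique (last r) (last r′) = cong (C ∷_) (Run-unique r r′)

-- The map Φ

-- Unary code of the block lengths, one bit per C. It trades the absolute positions that `markD`
-- looks up for bits that `mark` consumes one per N.
bits : List ℕ → List Bool
bits []           = []
bits (zero ∷ ts)  = bits ts
bits (suc t ∷ ts) = replicate t false ++ true ∷ bits ts

mark : List Bool → List Letter → List Letter
mark bs       []      = []
mark bs       (E ∷ w) = E ∷ mark bs w
mark bs       (C ∷ w) = C ∷ mark bs w
mark bs       (D ∷ w) = D ∷ mark bs w
mark []       (N ∷ w) = N ∷ mark [] w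
mark (b ∷ bs) (N ∷ w) = (if b then D else N) ∷ mark bs w

elemᵇ-partialSums : ∀ {v a} ts → v < a → elemᵇ v (partialSums a ts) ≡ false
elemᵇ-partialSums [] v<a = refl
elemᵇ-partialSums {v} {a} (t ∷ ts) v<a
  rewrite ≢⇒≡ᵇ-false (<⇒≢ (<-≤-trans v<a (m≤m+n a t))) =
  elemᵇ-partialSums ts (<-≤-trans v<a (m≤m+n a t))

markD-∷ : ∀ {c x} ls w → x ≤ c → markD c (x ∷ ls) w ≡ markD c ls w
markD-∷ ls [] x≤c = refl
markD-∷ ls (E ∷ w) x≤c = cong (E ∷_) (markD-∷ ls w x≤c)
markD-∷ {c} {x} ls (N ∷ w) x≤c
  rewrite ≢⇒≡ᵇ-false (≢-sym (<⇒≢ (s≤s x≤c))) = cong (_ ∷_) (markD-∷ ls w (m≤n⇒m≤1+n x≤c))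
markD-∷ ls (C ∷ w) x≤c = cong (C ∷_) (markD-∷ ls w x≤c)
markD-∷ ls (D ∷ w) x≤c = cong (D ∷_) (markD-∷ ls w x≤c)

markD-hit : ∀ c ls w → markD c (suc c ∷ ls) (N ∷ w) ≡ D ∷ markD (suc c) ls w
markD-hit c ls w rewrite ≡ᵇ-refl c = cong (D ∷_) (markD-∷ ls w ≤-refl)

markD-miss : ∀ c t ts w → let ls = partialSums (suc c) (suc t ∷ ts) in
  markD c ls (N ∷ w) ≡ N ∷ markD (suc c) ls w
markD-miss c t ts w
  rewrite elemᵇ-partialSums {suc c} ts (s≤s (m<m+n c (s≤s (z≤n {t}))))
        | ≢⇒≡ᵇ-false (<⇒≢ (m<m+n c (s≤s (z≤n {t})))) = refl

-- Passing an N moves the base to `c + 1` and shortens or finishes the first block, so the partial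
-- sums keep their values.
markD-partialSums : ∀ c ts w → markD c (partialSums c ts) w ≡ mark (bits ts) w
markD-partialSums c ts [] = refl
markD-partialSums c ts (E ∷ w) = cong (E ∷_) (markD-partialSums c ts w)
markD-partialSums c ts (C ∷ w) = cong (C ∷_) (markD-partialSums c ts w)
markD-partialSums c ts (D ∷ w) = cong (D ∷_) (markD-partialSums c ts w)
markD-partialSums c [] (N ∷ w) = cong (N ∷_) (markD-partialSums (suc c) [] w)
markD-partialSums c (zero ∷ ts) (N ∷ w) = begin
  markD c (partialSums c (0 ∷ ts)) (N ∷ w) ≡⟨ cong (λ a → markD c (a ∷ partialSums a ts) (N ∷ w)) (+-identityʳ c) ⟩
  markD c (c ∷ partialSums c ts) (N ∷ w)   ≡⟨ markD-∷ (partialSums c ts) (N ∷ w) ≤-refl ⟩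
  markD c (partialSums c ts) (N ∷ w)       ≡⟨ markD-partialSums c ts (N ∷ w) ⟩
  mark (bits ts) (N ∷ w) ∎
  where open ≡-Reasoning
markD-partialSums c (suc zero ∷ ts) (N ∷ w) = begin
  markD c (partialSums c (1 ∷ ts)) (N ∷ w)           ≡⟨ cong (λ a → markD c (a ∷ partialSums a ts) (N ∷ w)) (+-comm c 1) ⟩
  markD c (suc c ∷ partialSums (suc c) ts) (N ∷ w)   ≡⟨ markD-hit c (partialSums (suc c) ts) w ⟩
  D ∷ markD (suc c) (partialSums (suc c) ts) w       ≡⟨ cong (D ∷_) (markD-partialSums (suc c) ts w) ⟩
  D ∷ mark (bits ts) w ∎
  where open ≡-Reasoning
markD-partialSums c (suc (suc t) ∷ ts) (N ∷ w) = begin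
  markD c (partialSums c (suc (suc t) ∷ ts)) (N ∷ w)
    ≡⟨ cong (λ a → markD c (a ∷ partialSums a ts) (N ∷ w)) (+-suc c (suc t)) ⟩
  markD c (partialSums (suc c) (suc t ∷ ts)) (N ∷ w)
    ≡⟨ markD-miss c t ts w ⟩
  N ∷ markD (suc c) (partialSums (suc c) (suc t ∷ ts)) w
    ≡⟨ cong (N ∷_) (markD-partialSums (suc c) (suc t ∷ ts) w) ⟩
  N ∷ mark (bits (suc t ∷ ts)) w ∎
  where open ≡-Reasoning

-- Evaluating Φ on the word of a run

replicate-++-∷ : ∀ {A : Set} k (x : A) ys → replicate (suc k) x ++ ys ≡ replicate k x ++ x ∷ ys
replicate-++-∷ zero    x ys = refl
replicate-++-∷ (suc k) x ys = cong (x ∷_) (replicate-++-∷ k x ys)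

-- A word read by `Run` never starts with C, so this EN opens no block; the cases only expose the
-- start of `w` to `phiT`.
phiT-EN : ∀ {h q w p} → Run h q w p → phiT (E ∷ N ∷ w) ≡ E ∷ N ∷ phiT w
phiT-EN done = refl
phiT-EN (push _) = refl
phiT-EN (shift _ _) = refl
phiT-EN (burst _ _) = refl

-- A nonempty first stack excludes `burst`, so an N right after this E is a `shift` and no C follows
-- it.
phiT-push : ∀ {h q w p} → Run (suc h) q w p → phiT (E ∷ w) ≡ E ∷ phiT w
phiT-push (push _) = refl
phiT-push (shift _ r) = phiT-EN r

taus-EN : ∀ {h q w p} → Run h q w p → taus (E ∷ N ∷ w) ≡ taus w
taus-EN done = refl
taus-EN (push _) = refl
taus-EN (shift _ _) = refl
taus-EN (burst _ _) = refl

taus-push : ∀ {h q w p} → Run (suc h) q w p → taus (E ∷ w) ≡ taus w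
taus-push (push _) = refl
taus-push (shift _ r) = taus-EN r

skipC-run : ∀ {h q w p} → Run h q w p → skipC w ≡ phiT w
skipC-run done = refl
skipC-run (push _) = refl
skipC-run (shift _ _) = refl
skipC-run (burst _ _) = refl

countC-run : ∀ {h q w p} k → Run h q w p → countC k w ≡ k ∷ taus w
countC-run k done = refl
countC-run k (push _) = refl
countC-run k (shift _ _) = refl
countC-run k (burst _ _) = refl

mark-row : ∀ {b l} → Row b l → (if b then D else N) ≡ l
mark-row north = refl
mark-row diag  = refl

-- The C's left in `w` carry first the queued bits and then `bs`, the bits of the rows of `p`. In
-- `mark-drain`, `k` counts the C's of the current block already read, whose bits were clear.
mark-run : ∀ {h q w p} → Run h q w p →
  ∃[ bs ] bits (taus w) ≡ q ++ bs × mark bs (phiT w) ≡ p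
mark-drain : ∀ {q w p} k → Drain q (C ∷ w) p →
  ∃[ bs ] bits (countC (suc k) w) ≡ replicate k false ++ q ++ bs × mark bs (skipC w) ≡ p
mark-run done = [] , refl , refl
mark-run (push r) with mark-run r
... | bs , e₁ , e₂ rewrite taus-push r | phiT-push r = bs , e₁ , cong (E ∷_) e₂
mark-run (shift {q = q} {b = b} x r) with mark-run r
... | bs , e₁ , e₂ = b ∷ bs , trans e₁ (++-assoc q [ b ] bs) , cong₂ _∷_ (mark-row x) e₂
mark-run (burst {q = q} {b = b} {w = C ∷ w} x d) with mark-drain 0 d
... | bs , e₁ , e₂ = b ∷ bs , trans e₁ (++-assoc q [ b ] bs) , cong₂ _∷_ (mark-row x) e₂
mark-run (burst {q = q} {w = []} x ())
mark-run (burst {q = q} {w = E ∷ w} x ())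
mark-run (burst {q = q} {w = N ∷ w} x ())
mark-run (burst {q = q} {w = D ∷ w} x ())
mark-drain k (more {q = q} {w = C ∷ w} d) with mark-drain (suc k) d
... | bs , e₁ , e₂ = bs , trans e₁ (replicate-++-∷ k false (q ++ bs)) , e₂
mark-drain k (last r) with mark-run r
... | bs , e₁ , e₂ rewrite countC-run (suc k) r | skipC-run r =
  bs , cong (λ z → replicate k false ++ true ∷ z) e₁ , e₂

dropLast-∷ʳ : ∀ p l → dropLast (p ∷ʳ l) ≡ p
dropLast-∷ʳ [] l = refl
dropLast-∷ʳ (x ∷ []) l = refl
dropLast-∷ʳ (x ∷ y ∷ p) l = cong (x ∷_) (dropLast-∷ʳ (y ∷ p) l)

Φ-run : ∀ {w p} → Run 0 [] w p → Φ w ≡ dropLast p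
Φ-run {w} r with mark-run r
... | bs , e₁ , e₂ = cong dropLast (begin
  markD 0 (partialSums 0 (taus w)) (phiT w) ≡⟨ markD-partialSums 0 (taus w) (phiT w) ⟩
  mark (bits (taus w)) (phiT w)             ≡⟨ cong (λ z → mark z (phiT w)) e₁ ⟩
  mark bs (phiT w)                          ≡⟨ e₂ ⟩
  _ ∎)
  where open ≡-Reasoning

length-∷ʳ : ∀ {A : Set} (xs : List A) x → length (xs ∷ʳ x) ≡ suc (length xs)
length-∷ʳ xs x = trans (length-++ xs) (+-comm (length xs) 1)

-- Schröder paths

X Y : List Letter → ℕ
X p = proj₁ (endpoint p)
Y p = proj₂ (endpoint p)

-- Paths weakly below the diagonal that start at a point with x − y = a and
-- end on the diagonal.
data Below : ℕ → List Letter → Set where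
  []    : Below 0 []
  east  : ∀ {a p} → Below (suc a) p → Below a (E ∷ p)
  north : ∀ {a p} → Below a p → Below (suc a) (N ∷ p)
  diag  : ∀ {a p} → Below a p → Below a (D ∷ p)

below⇒schröder : ∀ {a p} → Below a p →
  AllSteps p × (∀ k → Y (take k p) ≤ a + X (take k p)) × a + X p ≡ Y p
below⇒schröder [] = [] , (λ { zero → z≤n ; (suc k) → z≤n }) , refl
below⇒schröder {a} (east {p = p} b) with below⇒schröder b
... | s , le , e = tt ∷ s
  , (λ { zero → z≤n ; (suc k) → ≤-trans (le k) (≤-reflexive (sym (+-suc a _))) })
  , trans (+-suc a (X p)) e
below⇒schröder (north b) with below⇒schröder b
... | s , le , e = tt ∷ s , (λ { zero → z≤n ; (suc k) → s≤s (le k) }) , cong suc e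
below⇒schröder {a} (diag {p = p} b) with below⇒schröder b
... | s , le , e = tt ∷ s
  , (λ { zero → z≤n ; (suc k) → ≤-trans (s≤s (le k)) (≤-reflexive (sym (+-suc a _))) })
  , trans (+-suc a (X p)) (cong suc e)

schröder⇒below : ∀ {a p} → AllSteps p → (∀ k → Y (take k p) ≤ a + X (take k p)) → a + X p ≡ Y p →
  Below a p
schröder⇒below {zero} [] le e = []
schröder⇒below {a} {E ∷ p} (_ ∷ s) le e =
  east (schröder⇒below s (λ k → ≤-trans (le (suc k)) (≤-reflexive (+-suc a _))) (trans (sym (+-suc a _)) e))
schröder⇒below {zero} {N ∷ p} (_ ∷ s) le e with le 1
... | ()
schröder⇒below {suc a} {N ∷ p} (_ ∷ s) le e =
  north (schröder⇒below s (λ k → s≤s⁻¹ (le (suc k))) (suc-injective e))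
schröder⇒below {a} {D ∷ p} (_ ∷ s) le e =
  diag (schröder⇒below s (λ k → s≤s⁻¹ (≤-trans (le (suc k)) (≤-reflexive (+-suc a _))))
    (suc-injective (trans (sym (+-suc a _)) e)))

trues : List Bool → ℕ
trues []          = 0
trues (true ∷ q)  = suc (trues q)
trues (false ∷ q) = trues q

trues-∷ʳ-false : ∀ q → trues (q ∷ʳ false) ≡ trues q
trues-∷ʳ-false [] = refl
trues-∷ʳ-false (true ∷ q) = cong suc (trues-∷ʳ-false q)
trues-∷ʳ-false (false ∷ q) = trues-∷ʳ-false q

trues-∷ʳ-true : ∀ q → trues (q ∷ʳ true) ≡ suc (trues q)
trues-∷ʳ-true [] = refl
trues-∷ʳ-true (true ∷ q) = cong suc (trues-∷ʳ-true q)
trues-∷ʳ-true (false ∷ q) = trues-∷ʳ-true q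


-- An E raises `h`, a `shift` lowers it and may queue a set bit, a `burst` may queue one and removes
-- one. A nonempty path ends in D because the last queued bit has to end the last block.
run⇒below : ∀ {h q w p} → Run h q w p →
  (h ≡ 0 × q ≡ [] × p ≡ []) ⊎ ∃[ p₀ ] p ≡ p₀ ∷ʳ D × Below (h + trues q) p₀
drain⇒below : ∀ {q w p} → Drain q w p →
  (∃[ q₀ ] q ≡ q₀ ∷ʳ true × trues q₀ ≡ 0 × p ≡ []) ⊎
  (∃[ p₀ ] p ≡ p₀ ∷ʳ D × ∃[ a ] trues q ≡ suc a × Below a p₀)
run⇒below done = inj₁ (refl , refl , refl)
run⇒below (push r) with run⇒below r
... | inj₂ (p₀ , refl , b) = inj₂ (E ∷ p₀ , refl , east b)
run⇒below (shift {q = q} x r) with run⇒below r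
run⇒below (shift {q = []} x r) | inj₁ (_ , () , _)
run⇒below (shift {q = _ ∷ _} x r) | inj₁ (_ , () , _)
run⇒below (shift {h = h} {q = q} north r) | inj₂ (p₀ , refl , b) =
  inj₂ (N ∷ p₀ , refl , north (subst (λ a → Below a p₀) (cong (h +_) (trues-∷ʳ-false q)) b))
run⇒below (shift {h = h} {q = q} diag r) | inj₂ (p₀ , refl , b) =
  inj₂ (D ∷ p₀ , refl ,
    diag (subst (λ a → Below a p₀) (trans (cong (h +_) (trues-∷ʳ-true q)) (+-suc h (trues q))) b))
run⇒below (burst {q = q} x d) with drain⇒below d
run⇒below (burst {q = q} x d) | inj₁ (q₀ , e , z , refl) with ∷ʳ-injective q q₀ e
-- The drain uses up the queue, so the bit just queued is its final, set one: this row is the last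
-- D, and no set bit was waiting before it.
run⇒below (burst {q = q} diag d) | inj₁ (q₀ , e , z , refl) | refl , refl =
  inj₂ ([] , refl , subst (λ a → Below a []) (sym z) [])
run⇒below (burst {q = q} north d) | inj₂ (p₀ , refl , a , e , b) =
  inj₂ (N ∷ p₀ , refl , subst (λ a → Below a (N ∷ p₀)) (trans (sym e) (trues-∷ʳ-false q)) (north b))
run⇒below (burst {q = q} diag d) | inj₂ (p₀ , refl , a , e , b) =
  inj₂ (D ∷ p₀ , refl ,
    diag (subst (λ a → Below a p₀) (suc-injective (trans (sym e) (trues-∷ʳ-true q))) b))
drain⇒below (more d) with drain⇒below d
... | inj₁ (q₀ , refl , z , e) = inj₁ (false ∷ q₀ , refl , z , e)
... | inj₂ b = inj₂ b
drain⇒below (last r) with run⇒below r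
... | inj₁ (_ , refl , e) = inj₁ ([] , refl , refl , e)
... | inj₂ (p₀ , e , b) = inj₂ (p₀ , e , _ , refl , b)

-- Reconstructing a word from a path

drain-last : ∀ q → trues q ≡ 0 → ∃[ w ] Drain (q ∷ʳ true) w []
drain-last [] z = _ , last done
drain-last (false ∷ q) z with drain-last q z
... | _ , d = _ , more d

-- Empties the queue through its first set bit. It takes a continuation because the rest of the word
-- is built only once `q′` is known.
drain-next : ∀ {a} q → trues q ≡ suc a →
  ∃[ q′ ] trues q′ ≡ a × (∀ {w p} → Run 0 q′ w p → ∃[ w′ ] Drain q w′ p)
drain-next (true ∷ q) e = q , suc-injective e , λ r → _ , last r
drain-next (false ∷ q) e with drain-next q e
... | q′ , e′ , f = q′ , e′ , λ r → _ , more (proj₂ (f r))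

-- When a row is met with `h` zero, the height equation supplies a set bit to end its block. In
-- `below⇒run-row`, `a` is the height after the row, whose bit is already counted.
below⇒run : ∀ {a p} h q → a ≡ h + trues q → Below a p → ∃[ w ] Run h q w (p ∷ʳ D)
below⇒run-row : ∀ {a b l p} h q → Row b l → suc a ≡ h + trues (q ∷ʳ b) → Below a p →
  ∃[ w ] Run h q w (l ∷ p ∷ʳ D)
below⇒run zero q e [] = _ , burst diag (proj₂ (drain-last q (sym e)))
below⇒run h q e (east b) = _ , push (proj₂ (below⇒run (suc h) q (cong suc e) b))
below⇒run h q e (north b) =
  below⇒run-row h q north (trans e (cong (h +_) (sym (trues-∷ʳ-false q)))) b
below⇒run h q e (diag b) = below⇒run-row h q diag
  (trans (cong suc e) (trans (sym (+-suc h (trues q))) (cong (h +_) (sym (trues-∷ʳ-true q))))) b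
below⇒run-row zero q x e b with drain-next (q ∷ʳ _) (sym e)
... | q′ , e′ , f = _ , burst x (proj₂ (f (proj₂ (below⇒run 0 q′ (sym e′) b))))
below⇒run-row (suc h) q x e b = _ , shift x (proj₂ (below⇒run h (q ∷ʳ _) (suc-injective e) b))

-- The machine

-- The values still due after `c` outputs, indexed so that the next output strips the head by
-- computation.
rng : ℕ → ℕ → List ℕ
rng c zero    = []
rng c (suc k) = suc c ∷ rng (suc c) k

vals-suc : ∀ c → vals c ++ [ suc c ] ≡ vals (suc c)
vals-suc c = trans (sym (map-++ suc (upTo c) [ c ])) (cong (map suc) (upTo-∷ʳ c))

vals-++-rng : ∀ c k → vals (c + k) ≡ vals c ++ rng c k
vals-++-rng c zero = trans (cong vals (+-identityʳ c)) (sym (++-identityʳ (vals c)))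
vals-++-rng c (suc k) = begin
  vals (c + suc k)                  ≡⟨ cong vals (+-suc c k) ⟩
  vals (suc c + k)                  ≡⟨ vals-++-rng (suc c) k ⟩
  vals (suc c) ++ rng (suc c) k     ≡⟨ cong (_++ rng (suc c) k) (vals-suc c) ⟨
  (vals c ++ [ suc c ]) ++ rng (suc c) k ≡⟨ ++-assoc (vals c) [ suc c ] (rng (suc c) k) ⟩
  vals c ++ rng c (suc k) ∎
  where open ≡-Reasoning

rng-> : ∀ c k → All (c <_) (rng c k)
rng-> c zero = []
rng-> c (suc k) = ≤-refl ∷ All.map (<-trans (n<1+n c)) (rng-> (suc c) k)

vals-≤ : ∀ c → All (_≤ c) (vals c)
vals-≤ zero = []
vals-≤ (suc c) = subst (All (_≤ suc c)) (vals-suc c) (++⁺ (All.map m≤n⇒m≤1+n (vals-≤ c)) (≤-refl ∷ []))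

elemᵇ-∈ : ∀ {v xs} → v ∈ xs → elemᵇ v xs ≡ true
elemᵇ-∈ {v} (here refl) rewrite ≡ᵇ-refl v = refl
elemᵇ-∈ {v} {x ∷ xs} (there v∈xs) = trans (cong ((v ≡ᵇ x) ∨_) (elemᵇ-∈ v∈xs)) (∨-zeroʳ (v ≡ᵇ x))

elemᵇ-∉ : ∀ {v xs} → All (v ≢_) xs → elemᵇ v xs ≡ false
elemᵇ-∉ [] = refl
elemᵇ-∉ (v≢x ∷ v∉xs) rewrite ≢⇒≡ᵇ-false v≢x = elemᵇ-∉ v∉xs

filterᵇ-none-++ : ∀ p {xs} ys → All (λ x → p x ≡ false) xs → filterᵇ p (xs ++ ys) ≡ filterᵇ p ys
filterᵇ-none-++ p ys [] = refl
filterᵇ-none-++ p ys (px ∷ pxs) rewrite px = filterᵇ-none-++ p ys pxs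

filterᵇ-all : ∀ p {xs} → All (λ x → p x ≡ true) xs → filterᵇ p xs ≡ xs
filterᵇ-all p [] = refl
filterᵇ-all p (px ∷ pxs) rewrite px = cong (_ ∷_) (filterᵇ-all p pxs)

notYetOutput-vals : ∀ c k {i s₁ s₂} → notYetOutput (c + k) (mstate i s₁ s₂ (vals c)) ≡ rng c k
notYetOutput-vals c k = begin
  filterᵇ p (vals (c + k))       ≡⟨ cong (filterᵇ p) (vals-++-rng c k) ⟩
  filterᵇ p (vals c ++ rng c k)  ≡⟨ filterᵇ-none-++ p {vals c} (rng c k) (All.tabulate (cong not ∘ elemᵇ-∈)) ⟩
  filterᵇ p (rng c k)            ≡⟨ filterᵇ-all p (All.map new (rng-> c k)) ⟩
  rng c k ∎
  where
  open ≡-Reasoning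
  p = λ v → not (elemᵇ v (vals c))
  new : ∀ {v} → c < v → p v ≡ true
  new c<v = cong not (elemᵇ-∉ (All.map (λ x≤c → ≢-sym (<⇒≢ (≤-<-trans x≤c c<v))) (vals-≤ c)))

HeadNot : ℕ → List ℕ → Set
HeadNot v []      = ⊤
HeadNot v (t ∷ _) = t ≢ v

step1ᵇ-head : ∀ n {i s₁ s₂ o v r} → notYetOutput n (mstate i s₁ (v ∷ s₂) o) ≡ v ∷ r →
  step1ᵇ n (mstate i s₁ (v ∷ s₂) o) ≡ true
step1ᵇ-head n {v = v} e rewrite e = ≡ᵇ-refl v

step1ᵇ-not-head : ∀ n {i s₁ s₂ o v r} → notYetOutput n (mstate i s₁ s₂ o) ≡ v ∷ r → HeadNot v s₂ →
  step1ᵇ n (mstate i s₁ s₂ o) ≡ false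
step1ᵇ-not-head n {s₂ = []} e h = refl
step1ᵇ-not-head n {s₂ = t ∷ s₂} e h rewrite e = ≢⇒≡ᵇ-false h

step2ᵇ-singleton : ∀ n {i s₂ o v r} → notYetOutput n (mstate i [ v ] s₂ o) ≡ v ∷ r →
  step2ᵇ n (mstate i [ v ] s₂ o) ≡ true
step2ᵇ-singleton n {v = v} e rewrite e | ≡ᵇ-refl v = refl

-- The entries moved by step (2) would include the value due next, which the first stack lacks.
step2ᵇ-∉ : ∀ n {i s₁ s₂ o v r} → notYetOutput n (mstate i s₁ s₂ o) ≡ v ∷ r → All (v ≢_) s₁ →
  step2ᵇ n (mstate i s₁ s₂ o) ≡ false
step2ᵇ-∉ n {s₁ = []} e v∉ = refl
step2ᵇ-∉ n {s₁ = x ∷ s₁} {v = v} {r = r} e v∉ rewrite e | elemᵇ-∉ v∉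
  | ∧-zeroʳ (allᵇ (λ y → elemᵇ y (v ∷ take (length s₁) r)) (x ∷ s₁)) = ∧-zeroʳ _

adiStage-step1 : ∀ n s → step1ᵇ n s ≡ true → adiStage n s ≡ [ C ]
adiStage-step1 n s e rewrite e = refl

adiStage-step2 : ∀ n s → step1ᵇ n s ≡ false → step2ᵇ n s ≡ true →
  adiStage n s ≡ replicate (length (stack1 s)) N
adiStage-step2 n s e₁ e₂ rewrite e₁ | e₂ = refl

adiStage-step3 : ∀ n s {b} → step1ᵇ n s ≡ false → step2ᵇ n s ≡ false → step3ᵇ s ≡ b →
  adiStage n s ≡ (if b then [ E ] else [ N ])
adiStage-step3 n s e₁ e₂ e₃ rewrite e₁ | e₂ | e₃ = refl

stage-C : ∀ c k {i s₁ s₂} → adiStage (c + suc k) (mstate i s₁ (suc c ∷ s₂) (vals c)) ≡ [ C ]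
stage-C c k {i} {s₁} {s₂} =
  adiStage-step1 (c + suc k) (mstate i s₁ (suc c ∷ s₂) (vals c))
    (step1ᵇ-head (c + suc k) {i} {s₁} {s₂} {vals c} (notYetOutput-vals c (suc k) {i} {s₁} {suc c ∷ s₂}))

stage-N : ∀ c k {i s₂} → HeadNot (suc c) s₂ →
  adiStage (c + suc k) (mstate i [ suc c ] s₂ (vals c)) ≡ [ N ]
stage-N c k {i} {s₂} h =
  adiStage-step2 n (mstate i [ suc c ] s₂ (vals c))
    (step1ᵇ-not-head n {i} {[ suc c ]} {s₂} {vals c} new h)
    (step2ᵇ-singleton n {i} {s₂} {vals c} new)
  where
  n = c + suc k
  new = notYetOutput-vals c (suc k) {i} {[ suc c ]} {s₂}

stage-EN : ∀ c k {i s₁ s₂ b} → HeadNot (suc c) s₂ → All (suc c <_) s₁ →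
  step3ᵇ (mstate i s₁ s₂ (vals c)) ≡ b →
  adiStage (c + suc k) (mstate i s₁ s₂ (vals c)) ≡ (if b then [ E ] else [ N ])
stage-EN c k {i} {s₁} {s₂} h s₁> =
  adiStage-step3 n (mstate i s₁ s₂ (vals c))
    (step1ᵇ-not-head n {i} {s₁} {s₂} {vals c} new h)
    (step2ᵇ-∉ n {i} {s₁} {s₂} {vals c} new (All.map <⇒≢ s₁>))
  where
  n = c + suc k
  new = notYetOutput-vals c (suc k) {i} {s₁} {s₂}

row : ∀ b → ∃[ l ] Row b l
row true  = D , diag
row false = N , north

Y-row : ∀ {b l} → Row b l → ∀ p → Y (l ∷ p) ≡ suc (Y p)
Y-row north p = refl
Y-row diag  p = refl

-- From ADI words to runs

remaining : ∀ {xs c k x} → xs ↭ rng c k → x ∈ xs → c < x × ∃[ k′ ] k ≡ suc k′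
remaining {c = c} {k} xs↭ x∈xs = All.lookup (rng-> c k) x∈rng , positive k x∈rng
  where
  x∈rng = ∈-resp-↭ xs↭ x∈xs
  positive : ∀ k → _ ∈ rng c k → ∃[ k′ ] k ≡ suc k′
  positive (suc k) _ = k , refl

not-done : ∀ {i s₁ s₂ o c k} → i ++ s₁ ++ s₂ ↭ rng c (suc k) → isDoneᵇ (mstate i s₁ s₂ o) ≡ false
not-done {x ∷ i} _ = refl
not-done {[]} {x ∷ s₁} _ = refl
not-done {[]} {[]} {x ∷ s₂} _ = refl
not-done {[]} {[]} {[]} []↭ with ↭-length []↭
... | ()

runADI-step : ∀ {n} f {s l w} → isDoneᵇ s ≡ false → adiStage n s ≡ [ l ] → runADI n f s ≡ just w →
  ∃[ f′ ] ∃[ s′ ] ∃[ w′ ] f ≡ suc f′ × w ≡ l ∷ w′ × applyOp l s ≡ just s′ × runADI n f′ s′ ≡ just w′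
runADI-step zero d st e rewrite d with e
... | ()
runADI-step {n} (suc f) {s} {l} d st e rewrite d | st with applyOp l s
... | just s′ with runADI n f s′ in eq
runADI-step {n} (suc f) {s} {l} d st refl | just s′ | just w = f , s′ , w , refl , cong (_++ w) st , refl , eq

runADI-done : ∀ {n f o w} → runADI n f (mstate [] [] [] o) ≡ just w → w ≡ []
runADI-done {f = zero} refl = refl
runADI-done {f = suc f} refl = refl

∧-trueʳ : ∀ {a b} → a ∧ b ≡ true → b ≡ true
∧-trueʳ {true} e = e

-- Step (3) only puts `x` on a smaller top. Applied to `x` equal to `c + 1`, this is why that value
-- enters an empty first stack.
step3ᵇ-empty : ∀ {x i s₁ s₂ o} → step3ᵇ (mstate (x ∷ i) s₁ s₂ o) ≡ true → All (x <_) s₁ → s₁ ≡ []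
step3ᵇ-empty e [] = refl
step3ᵇ-empty {x} {s₁ = t ∷ _} e (x<t ∷ _) =
  ⊥-elim (<-asym x<t (<ᵇ⇒< t x (Equivalence.from T-≡ (∧-trueʳ e))))

runADI-vals-suc : ∀ {c k} f {i s₁ s₂ w} →
  runADI (c + suc k) f (mstate i s₁ s₂ (vals c ++ [ suc c ])) ≡ just w →
  runADI (suc c + k) f (mstate i s₁ s₂ (vals (suc c))) ≡ just w
runADI-vals-suc {c} {k} f {i} {s₁} {s₂} {w} =
  subst₂ (λ n o → runADI n f (mstate i s₁ s₂ o) ≡ just w) (+-suc c k) (vals-suc c)

-- The bits depend on the future of the word, so the state fixes only their number. Every entry not
-- yet on the second stack has one N, hence one row, to come.
Explained : List ℕ → List ℕ → List ℕ → List Letter → Set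
Explained i s₁ s₂ w =
  ∃[ q ] ∃[ p ] length q ≡ length s₂ × Run (length s₁) q w p × Y p ≡ length s₁ + length i

-- The state just after a C. Whether the block goes on decides the bit of that C, which `drained-C`
-- then supplies.
ExplainedDrain : List ℕ → List ℕ → List Letter → Set
ExplainedDrain i s₂ w = ∃[ q ] ∃[ p ] length q ≡ length s₂ × (Drain q w p ⊎ Run 0 q w p) × Y p ≡ length i

drained-C : ∀ {i s₂ t w} → ExplainedDrain i s₂ w →
  ∃[ q ] ∃[ p ] length q ≡ length (t ∷ s₂) × Drain q (C ∷ w) p × Y p ≡ length i
drained-C (q , p , l , inj₁ d , y) = false ∷ q , p , cong suc l , more d , y
drained-C (q , p , l , inj₂ r , y) = true ∷ q , p , cong suc l , last r , y

-- Recursion on the fuel. The invariants keep `c + 1` out of the first stack and off the top of the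
-- second, so steps (1) and (2) fail; once `c + 1` enters, `runADI⇒burst` takes over.
runADI⇒run : ∀ f c k {i s₁ s₂ w} → i ++ s₁ ++ s₂ ↭ rng c k → All (suc c <_) s₁ → HeadNot (suc c) s₂ →
  runADI (c + k) f (mstate i s₁ s₂ (vals c)) ≡ just w → Explained i s₁ s₂ w
runADI⇒drain : ∀ f c k {i s₂ w} → i ++ s₂ ↭ rng c k →
  runADI (c + k) f (mstate i [] s₂ (vals c)) ≡ just w → ExplainedDrain i s₂ w
runADI⇒burst : ∀ f c k {i s₂ w} → suc c ∷ i ++ s₂ ↭ rng c (suc k) → HeadNot (suc c) s₂ →
  runADI (c + suc k) f (mstate i [ suc c ] s₂ (vals c)) ≡ just w → Explained (suc c ∷ i) [] s₂ (E ∷ w)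
runADI⇒run f c zero {[]} {[]} {[]} π s₁> h e with runADI-done {f = f} e
... | refl = [] , [] , refl , done , refl
runADI⇒run f c zero {x ∷ i} π s₁> h e with remaining {c = c} π (here refl)
... | ()
runADI⇒run f c zero {i} {x ∷ s₁} π s₁> h e with remaining {c = c} π (∈-insert i)
... | ()
runADI⇒run f c zero {[]} {[]} {x ∷ s₂} π s₁> h e with remaining {c = c} π (here refl)
... | ()
runADI⇒run f c (suc k) {i} {s₁} {s₂} π s₁> h e with step3ᵇ (mstate i s₁ s₂ (vals c)) in e₃
... | false with runADI-step f (not-done {i} {s₁} {s₂} π) (stage-EN c k h s₁> e₃) e
runADI⇒run f c (suc k) {i} {x ∷ s₁} {s₂} π (x> ∷ s₁>) h e
    | false | f′ , s′ , w′ , refl , refl , refl , e′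
  with runADI⇒run f′ c (suc k) {i} {s₁} {x ∷ s₂}
    (↭-trans (++⁺ˡ i (↭-shift x s₁ s₂)) π) s₁> (≢-sym (<⇒≢ x>)) e′
-- This N put one more entry on the second stack, so the later queue is nonempty and its last bit is
-- the bit of this row.
... | q , p , l , r , y with initLast q
... | q₀ ∷ʳ′ b with row b
... | a , ab = q₀ , a ∷ p
  , suc-injective (trans (sym (length-∷ʳ q₀ b)) l) , shift ab r , trans (Y-row ab p) (cong suc y)
runADI⇒run f c (suc k) {x ∷ i} {s₁} {s₂} π s₁> h e
    | true with runADI-step f (not-done {x ∷ i} {s₁} {s₂} {vals c} π) (stage-EN c k {x ∷ i} h s₁> e₃) e
... | f′ , s′ , w′ , refl , refl , refl , e′ with x ≟ suc c
... | yes refl with step3ᵇ-empty {i = i} {s₂ = s₂} {o = vals c} e₃ s₁>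
... | refl = runADI⇒burst f′ c k π h e′
runADI⇒run f c (suc k) {x ∷ i} {s₁} {s₂} π s₁> h e
    | true | f′ , s′ , w′ , refl , refl , refl , e′ | no x≢
  with runADI⇒run f′ c (suc k) {i} {x ∷ s₁} {s₂}
    (↭-trans (↭-shift x i (s₁ ++ s₂)) π)
    (≤∧≢⇒< (proj₁ (remaining π (here refl))) (≢-sym x≢) ∷ s₁>) h e′
... | q , p , l , r , y = q , E ∷ p , l , push r , trans y (sym (+-suc (length s₁) (length i)))
runADI⇒burst f c k {i} {s₂} π h e
  with runADI-step f (not-done {i} {[ suc c ]} {s₂} (↭-trans (↭-shift (suc c) i s₂) π))
    (stage-N c k {i} h) e
... | f₁ , _ , _ , refl , refl , refl , e₁
  with runADI-step f₁ (not-done {i} {[]} {suc c ∷ s₂} (↭-trans (↭-shift (suc c) i s₂) π))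
    (stage-C c k {i} {[]}) e₁
... | f₂ , _ , _ , refl , refl , refl , e₂
  with drained-C {i} {s₂} {suc c} (runADI⇒drain f₂ (suc c) k (drop-∷ π) (runADI-vals-suc f₂ e₂))
... | q , p , l , d , y with initLast q
... | q₀ ∷ʳ′ b with row b
... | a , ab = q₀ , a ∷ p
  , suc-injective (trans (sym (length-∷ʳ q₀ b)) l) , burst ab d , trans (Y-row ab p) (cong suc y)
runADI⇒drain f c k {i} {[]} π e with runADI⇒run f c k {i} {[]} {[]} π [] tt e
... | q , p , l , r , y = q , p , l , inj₂ r , y
runADI⇒drain f c zero {i} {t ∷ s₂} π e with remaining {c = c} π (∈-insert i)
... | ()
-- The block goes on exactly when the value due next is on top.
runADI⇒drain f c (suc k) {i} {t ∷ s₂} π e with t ≟ suc c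
... | no t≢ with runADI⇒run f c (suc k) {i} {[]} {t ∷ s₂} π [] t≢ e
... | q , p , l , r , y = q , p , l , inj₂ r , y
runADI⇒drain f c (suc k) {i} {t ∷ s₂} π e | yes refl
  with runADI-step f (not-done {i} {[]} {suc c ∷ s₂} π) (stage-C c k {i} {[]}) e
... | f₁ , _ , _ , refl , refl , refl , e₁
  with drained-C {i} {s₂} {suc c} (runADI⇒drain f₁ (suc c) k
    (drop-∷ (↭-trans (↭-sym (↭-shift (suc c) i s₂)) π)) (runADI-vals-suc f₁ e₁))
... | q , p , l , d , y = q , p , l , inj₁ d , y

-- From runs to ADI words

<⇒<ᵇ-true : ∀ {m n} → m < n → (m <ᵇ n) ≡ true
<⇒<ᵇ-true m<n = Equivalence.to T-≡ (<⇒<ᵇ m<n)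

decreasingᵇ-true : ∀ {xs} → AllPairs _>_ xs → decreasingᵇ xs ≡ true
decreasingᵇ-true [] = refl
decreasingᵇ-true ([] ∷ _) = refl
decreasingᵇ-true ((y<x ∷ _) ∷ xs>) rewrite <⇒<ᵇ-true y<x = decreasingᵇ-true xs>

increasingᵇ-true : ∀ {xs} → AllPairs _<_ xs → increasingᵇ xs ≡ true
increasingᵇ-true [] = refl
increasingᵇ-true ([] ∷ _) = refl
increasingᵇ-true ((x<y ∷ _) ∷ xs<) rewrite <⇒<ᵇ-true x<y = increasingᵇ-true xs<

stacksOKᵇ-true : ∀ {i s₁ s₂ o} → AllPairs _>_ s₁ → AllPairs _<_ s₂ → stacksOKᵇ (mstate i s₁ s₂ o) ≡ true
stacksOKᵇ-true dec inc = cong₂ _∧_ (decreasingᵇ-true dec) (increasingᵇ-true inc)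

step3ᵇ-true : ∀ {x i s₁ s₂ o} → All (x <_) s₂ → All (_< x) s₁ → step3ᵇ (mstate (x ∷ i) s₁ s₂ o) ≡ true
step3ᵇ-true [] [] = refl
step3ᵇ-true [] (t<x ∷ _) = <⇒<ᵇ-true t<x
step3ᵇ-true (x<t ∷ _) [] rewrite <⇒<ᵇ-true x<t = refl
step3ᵇ-true (x<t ∷ _) (u<x ∷ _) rewrite <⇒<ᵇ-true x<t = <⇒<ᵇ-true u<x

-- This is what forces an N: if the next input is below an `x` that N has just moved, then before
-- the move step (3) refused to put it on `x`.
NextBelow : List ℕ → List ℕ → Set
NextBelow []      s₂ = ⊤
NextBelow (z ∷ _) s₂ = All (z <_) s₂

NextBelow-tail : ∀ i {x s₂} → NextBelow i (x ∷ s₂) → NextBelow i s₂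
NextBelow-tail []      _         = tt
NextBelow-tail (z ∷ i) (_ ∷ z<) = z<

step3ᵇ-false : ∀ i {x s₁ s₂ o} → NextBelow i (x ∷ s₂) → step3ᵇ (mstate i (x ∷ s₁) s₂ o) ≡ false
step3ᵇ-false [] _ = refl
step3ᵇ-false (z ∷ i) {x} (z<x ∷ _)
  rewrite ¬-not (<-asym z<x ∘ <ᵇ⇒< x z ∘ Equivalence.from T-≡) = ∧-zeroʳ _

>⇒HeadNot : ∀ {v xs} → All (v <_) xs → HeadNot v xs
>⇒HeadNot [] = tt
>⇒HeadNot (v<x ∷ _) = ≢-sym (<⇒≢ v<x)

-- The algorithm and the legal run are followed together. The fuel `length w` is exact because every
-- stage here performs a single letter.
Accepts : ℕ → List Letter → MState → Set
Accepts n w s = runADI n (length w) s ≡ just w × runDI w s ≡ just (mstate [] [] [] (vals n))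

accepts-∷ : ∀ {n l w s′} s → isDoneᵇ s ≡ false → adiStage n s ≡ [ l ] → applyOp l s ≡ just s′ →
  stacksOKᵇ s′ ≡ true → Accepts n w s′ → Accepts n (l ∷ w) s
accepts-∷ {n} {l} {w} s d st op ok (adi-w , di-w) = adi-lw , di-lw
  where
  adi-lw : runADI n (suc (length w)) s ≡ just (l ∷ w)
  adi-lw rewrite d | st | op | adi-w = cong (λ v → just (v ++ w)) st
  di-lw : runDI (l ∷ w) s ≡ just (mstate [] [] [] (vals n))
  di-lw rewrite op | ok = di-w

-- A state that performs `w` and from which earlier letters can be undone. By `s₁>` and `s₂>` the
-- value `c + 1`, if still due, is in the input, so steps (1) and (2) fail; the order fields keep
-- undone entries legal.
record Armed (c h : ℕ) (q : List Bool) (w p : List Letter) : Set where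
  constructor armed
  field
    {i s₁ s₂} : List ℕ
    {k}       : ℕ
    len₁      : length s₁ ≡ h
    len₂      : length s₂ ≡ length q
    rows      : Y p ≡ h + length i
    perm      : i ++ s₁ ++ s₂ ↭ rng c k
    s₁>       : All (suc c <_) s₁
    s₂>       : All (suc c <_) s₂
    dec       : AllPairs _>_ s₁
    inc       : AllPairs _<_ s₂
    s₁<s₂     : All (λ x → All (x <_) s₂) s₁
    next      : NextBelow i s₂
    accepts   : Accepts (c + k) w (mstate i s₁ s₂ (vals c))

record Drained (c : ℕ) (q : List Bool) (w p : List Letter) : Set where
  constructor drained
  field
    {i s₂}  : List ℕ
    {k}     : ℕ
    len₂    : length s₂ ≡ length q
    rows    : Y p ≡ length i
    perm    : i ++ s₂ ↭ rng c k
    inc     : AllPairs _<_ s₂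
    accepts : Accepts (c + k) w (mstate i [] s₂ (vals c))

armed⇒drained : ∀ {c q w p} → Armed c 0 q w p → Drained c q w p
armed⇒drained (armed {s₁ = []} _ l₂ y π _ _ _ inc _ _ acc) = drained l₂ y π inc acc

-- Undoing E returns `x` to the input; being above the rest of the first stack and below the second,
-- it passes step (3).
armed-push : ∀ {c h q w p} → Armed c (suc h) q w p → Armed c h q (E ∷ w) (E ∷ p)
armed-push {c} {h} (armed {i} {x ∷ s₁} {s₂} {k} l₁ l₂ y π (x> ∷ s₁>) s₂> (x>s₁ ∷ dec) inc (x<s₂ ∷ s₁<s₂) nx acc)
  with remaining {c = c} π (∈-insert i)
... | _ , k′ , refl = armed {i = x ∷ i} (suc-injective l₁) l₂ (trans y (sym (+-suc h (length i))))
  (↭-trans (↭-sym (↭-shift x i (s₁ ++ s₂))) π) s₁> s₂> dec inc s₁<s₂ x<s₂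
  (accepts-∷ (mstate (x ∷ i) s₁ s₂ (vals c)) refl
    (stage-EN c k′ {x ∷ i} {s₁} {s₂} (>⇒HeadNot s₂>) s₁> (step3ᵇ-true {x} {i} {o = vals c} x<s₂ x>s₁)) refl
    (stacksOKᵇ-true {i} {o = vals c} (x>s₁ ∷ dec) inc) acc)

-- Undoing N puts `x` back on a first stack that `s₁<s₂` places below it.
armed-shift : ∀ {c h q b l w p} → Row b l → Armed c h (q ∷ʳ b) w p → Armed c (suc h) q (N ∷ w) (l ∷ p)
armed-shift {q = q} {b} _ (armed {s₂ = []} _ l₂ _ _ _ _ _ _ _ _ _) with trans l₂ (length-∷ʳ q b)
... | ()
armed-shift {c} {h} {q} {b} {p = p} ab
  (armed {i} {s₁} {x ∷ s₂} {k} l₁ l₂ y π s₁> (x> ∷ s₂>) dec (x<s₂ ∷ inc) s₁<s₂ nx acc)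
  with remaining {c = c} π (∈-++⁺ʳ i (∈-insert s₁))
... | _ , k′ , refl = armed (cong suc l₁) (suc-injective (trans l₂ (length-∷ʳ q b)))
  (trans (Y-row ab p) (cong suc y)) π′ (x> ∷ s₁>) s₂> (s₁<x ∷ dec) inc (x<s₂ ∷ All.map All.tail s₁<s₂)
  (NextBelow-tail i nx)
  (accepts-∷ (mstate i (x ∷ s₁) s₂ (vals c))
      (not-done {i} {x ∷ s₁} π′)
    (stage-EN c k′ {i} {x ∷ s₁} {s₂} (>⇒HeadNot s₂>) (x> ∷ s₁>) (step3ᵇ-false i nx)) refl
    (stacksOKᵇ-true {i} {o = vals c} dec (x<s₂ ∷ inc)) acc)
  where
  π′ = ↭-trans (++⁺ˡ i (↭-sym (↭-shift x s₁ s₂))) π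
  s₁<x = All.map All.head s₁<s₂

accepts-C : ∀ {c k i s₂ w} → i ++ s₂ ↭ rng (suc c) k → AllPairs _<_ s₂ →
  Accepts (suc c + k) w (mstate i [] s₂ (vals (suc c))) →
  Accepts (c + suc k) (C ∷ w) (mstate i [] (suc c ∷ s₂) (vals c))
accepts-C {c} {k} {i} {s₂} {w} π inc acc =
  accepts-∷ (mstate i [] (suc c ∷ s₂) (vals c))
      (not-done {i} {[]} {suc c ∷ s₂} {c = c} (↭-trans (↭-shift (suc c) i s₂) (prep (suc c) π)))
    (stage-C c k {i} {[]}) refl
    (stacksOKᵇ-true {i} {o = vals c ++ [ suc c ]} [] inc)
    (subst₂ (λ n o → Accepts n w (mstate i [] s₂ o)) (sym (+-suc c k)) (sym (vals-suc c)) acc)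

drained-> : ∀ {c k} i {s₂} → i ++ s₂ ↭ rng c k → All (c <_) s₂
drained-> {c} {k} i π = ++⁻ʳ i (All-resp-↭ (↭-sym π) (rng-> c k))

drained-∷ : ∀ {c b q w p} → Drained (suc c) q w p → Drained c (b ∷ q) (C ∷ w) p
drained-∷ {c} (drained {i} {s₂} l₂ y π inc acc) =
  drained (cong suc l₂) y (↭-trans (↭-shift (suc c) i s₂) (prep (suc c) π)) (drained-> i π ∷ inc)
    (accepts-C π inc acc)

-- Undoing E N C returns `c + 1` to the input and leaves the second stack alone. The queue gained a
-- bit at the back and lost one at the front, so only its length is compared.
armed-burst : ∀ {c q q′ l w p b} → Row b l → length q′ ≡ length q → Drained (suc c) q′ w p →
  Armed c 0 q (E ∷ N ∷ C ∷ w) (l ∷ p)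
armed-burst {c} {p = p} ab lq (drained {i} {s₂} {k} l₂ y π inc acc) =
  armed refl (trans l₂ lq) (trans (Y-row ab p) (cong suc y)) π₀ [] s₂> [] inc [] s₂>
    (accepts-∷ (mstate (suc c ∷ i) [] s₂ (vals c)) refl
      (stage-EN c k {suc c ∷ i} {[]} {s₂} (>⇒HeadNot s₂>) [] (step3ᵇ-true {suc c} {i} {o = vals c} s₂> [])) refl
      (stacksOKᵇ-true {i} {[ suc c ]} {o = vals c} ([] ∷ []) inc)
    (accepts-∷ (mstate i [ suc c ] s₂ (vals c))
      (not-done {i} {[ suc c ]} {s₂} (↭-trans (↭-shift (suc c) i s₂) π₀))
      (stage-N c k {i} (>⇒HeadNot s₂>)) refl
      (stacksOKᵇ-true {i} {o = vals c} [] (s₂> ∷ inc))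
    (accepts-C π inc acc)))
  where
  s₂> = drained-> i π
  π₀ = prep (suc c) π

-- The permutation is built on the way back from the empty machine, `c` rising by one per C.
-- `drain⇒drained` stops just after the first C of the block, whose value must be traced back to the
-- input and not to the second stack.
run⇒armed : ∀ {h q w p} c → Run h q w p → Armed c h q w p
drain⇒drained : ∀ {q w p} c → Drain q w p →
  ∃[ b ] ∃[ q′ ] ∃[ w′ ] q ≡ b ∷ q′ × w ≡ C ∷ w′ × Drained (suc c) q′ w′ p
run⇒armed c done = armed {k = 0} refl refl refl ↭-refl [] [] [] [] [] tt
  (refl , cong (λ n → just (mstate [] [] [] (vals n))) (sym (+-identityʳ c)))
run⇒armed c (push r) = armed-push (run⇒armed c r)
run⇒armed c (shift x r) = armed-shift x (run⇒armed c r)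
run⇒armed c (burst {q = q} {b} x d) with drain⇒drained c d
... | _ , q′ , w′ , eq , refl , dr =
  armed-burst x (suc-injective (trans (sym (cong length eq)) (length-∷ʳ q b))) dr
drain⇒drained c (more d) with drain⇒drained (suc c) d
... | _ , q′ , w′ , refl , refl , dr = _ , _ , _ , refl , refl , drained-∷ dr
drain⇒drained c (last r) = _ , _ , _ , refl , refl , armed⇒drained (run⇒armed (suc c) r)

-- Word lengths and the bijection

length-row : ∀ {b l} (q : List Bool) → Row b l → ∀ p →
  2 + (3 * Y p + length (q ∷ʳ b)) ≡ 3 * Y (l ∷ p) + length q
length-row {b} {l} q x p rewrite length-∷ʳ q b | Y-row x p = regroup (Y p) (length q)
  where
  regroup : ∀ y m → 2 + (3 * y + suc m) ≡ 3 * suc y + m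
  regroup = solve-∀

-- Each row left costs an E, an N and a C, but `h` of the E's are already done; each queued bit
-- costs one more C. At the start this matches the fuel of `adi`.
length-run : ∀ {h q w p} → Run h q w p → length w + h ≡ 3 * Y p + length q
length-drain : ∀ {q w p} → Drain q w p → length w ≡ 3 * Y p + length q
length-run done = refl
length-run {h} (push {w = w} r) = trans (sym (+-suc (length w) h)) (length-run r)
length-run (shift {h} {q} {w = w} {p} x r) =
  trans (cong suc (+-suc (length w) h)) (trans (cong (2 +_) (length-run r)) (length-row q x p))
length-run (burst {q} {w = w} {p} x d) =
  trans (cong (2 +_) (trans (+-identityʳ (length w)) (length-drain d))) (length-row q x p)
length-drain (more {q} {p = p} d) =
  trans (cong suc (length-drain d)) (sym (+-suc (3 * Y p) (length q)))
length-drain (last {q} {w} {p} r) =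
  trans (cong suc (trans (sym (+-identityʳ (length w))) (length-run r))) (sym (+-suc (3 * Y p) (length q)))

length-rng : ∀ c k → length (rng c k) ≡ k
length-rng c zero = refl
length-rng c (suc k) = cong suc (length-rng (suc c) k)

run⇒adi : ∀ {n w p} → Run 0 [] w p → Y p ≡ n → IsADIWord n w
run⇒adi {w = w} {p} r yp with run⇒armed 0 r
... | armed {π} {[]} {[]} {k} _ _ rows perm _ _ _ _ _ _ (adi-w , di-w) rewrite ++-identityʳ π
  with trans (trans (sym yp) rows) (trans (↭-length perm) (length-rng 0 k))
... | refl = π , subst (π ↭_) (sym (vals-++-rng 0 k)) perm
  -- The word itself witnesses DI-sortability.
  , (w , _ , subst (λ m → runDI w (initState π) ≡ just m) refl di-w , cong vals (sym len))
  , subst₂ (λ m f → runADI m f (initState π) ≡ just w) (sym len) fuel adi-w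
  where
  len : length π ≡ k
  len = trans (↭-length perm) (length-rng 0 k)
  fuel : length w ≡ 3 * length π
  fuel = trans (sym (+-identityʳ (length w)))
    (trans (length-run r) (trans (+-identityʳ (3 * Y p)) (cong (3 *_) rows)))

IsPerm-length : ∀ {n π} → IsPerm n π → length π ≡ n
IsPerm-length {n} perm = trans (↭-length perm) (trans (length-map suc (upTo n)) (length-upTo n))

adi⇒run : ∀ {n W} → IsADIWord n W → ∃[ p ] Run 0 [] W p × Y p ≡ n
adi⇒run {n} (π , perm , _ , e)
  with runADI⇒run (3 * length π) 0 (length π) {π} {[]} {[]} π↭ [] tt e
  where
  π↭ : π ++ [] ↭ rng 0 (length π)
  π↭ rewrite ++-identityʳ π | IsPerm-length perm = subst (π ↭_) (vals-++-rng 0 n) perm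
... | [] , p , _ , r , y = p , r , trans y (IsPerm-length perm)

-- A positive number of rows excludes the empty path, so there is a final D, the letter that Φ
-- drops.
run-∷ʳ : ∀ {w p m} → Run 0 [] w p → Y p ≡ suc m → ∃[ p₀ ] p ≡ p₀ ∷ʳ D × Below 0 p₀ × Φ w ≡ p₀
run-∷ʳ r y with run⇒below r
run-∷ʳ r () | inj₁ (_ , _ , refl)
... | inj₂ (p₀ , refl , b) = p₀ , refl , b , trans (Φ-run r) (dropLast-∷ʳ p₀ D)

Y-∷ʳ : ∀ p → Y (p ∷ʳ D) ≡ suc (Y p)
Y-∷ʳ [] = refl
Y-∷ʳ (E ∷ p) = Y-∷ʳ p
Y-∷ʳ (N ∷ p) = cong suc (Y-∷ʳ p)
Y-∷ʳ (D ∷ p) = cong suc (Y-∷ʳ p)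
Y-∷ʳ (C ∷ p) = Y-∷ʳ p

theorem3p7 : (n : ℕ) → 0 < n →
    ((W : List Letter) → IsADIWord n W → IsSchroderPath (n ∸ 1) (Φ W)) ×
    ((W W′ : List Letter) → IsADIWord n W → IsADIWord n W′ → Φ W ≡ Φ W′ → W ≡ W′) ×
    ((P : List Letter) → IsSchroderPath (n ∸ 1) P → ∃ λ W → IsADIWord n W × (Φ W ≡ P))
theorem3p7 (suc m) _ = into , injective , surjective
  where
  into : (W : List Letter) → IsADIWord (suc m) W → IsSchroderPath m (Φ W)
  into W W-adi with adi⇒run W-adi
  ... | p , r , y with run-∷ʳ r y
  ... | p₀ , refl , b , φ with below⇒schröder b | suc-injective (trans (sym (Y-∷ʳ p₀)) y)
  ... | steps , below , end | y₀ = subst (IsSchroderPath m) (sym φ)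
    (steps , below , cong₂ _,_ (trans end y₀) y₀)

  injective : (W W′ : List Letter) → IsADIWord (suc m) W → IsADIWord (suc m) W′ → Φ W ≡ Φ W′ → W ≡ W′
  injective W W′ W-adi W′-adi eq with adi⇒run W-adi | adi⇒run W′-adi
  ... | p , r , y | p′ , r′ , y′ with run-∷ʳ r y | run-∷ʳ r′ y′
  ... | p₀ , refl , _ , φ | p₀′ , refl , _ , φ′ with trans (sym φ) (trans eq φ′)
  -- Equal images give equal paths, and a path determines its word.
  ... | refl = Run-unique r r′

  surjective : (P : List Letter) → IsSchroderPath m P → ∃ λ W → IsADIWord (suc m) W × (Φ W ≡ P)
  surjective P (steps , below , end)
    with below⇒run 0 [] refl (schröder⇒below steps below (trans (cong proj₁ end) (sym (cong proj₂ end))))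
  ... | W , r = W , run⇒adi r (trans (Y-∷ʳ P) (cong (suc ∘ proj₂) end))
    , trans (Φ-run r) (dropLast-∷ʳ P D)
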